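{- There is no online algorithm for vector packing (VP) in dimension $d=8$ whose asymptotic competitive ratio is smaller than $\frac{76}{29}$ (approximately $2.620689655$).
   Context: Vector packing (VP) in dimension $d$: an item is a non-zero vector in $[0,1]^d$ with rational components. A packing of a finite collection of items is a partition of it into subsets called bins such that the vector sum of the items in every bin does not exceed $1$ in any component. For an input $L$ (a finite sequence of items), $OPT(L)$ is the minimum number of bins in a packing of the items of $L$. An online algorithm $A$ receives the items of $L$ one by one and packs each item irrevocably, before the next item is presented, into a new (empty) bin or into an already non-empty bin, keeping the packing feasible; its decisions are deterministic functions of the items presented so far (the total length of the input is not known to it). $A(L)$ denotes the number of bins $A$ uses for $L$. The asymptotic competitive ratio of $A$ is $$\lim_{K\to\infty}\ \sup_{L:\,OPT(L)\ge K}\ \frac{A(L)}{OPT(L)}\in[1,\infty].$$ -}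

module Defs where

open import Data.Fin.Base using (Fin)
open import Data.Fin.Properties using (all?)
open import Data.Integer.Base using (+_)
open import Data.List.Base using (List; []; _∷_; [_]; _++_; _∷ʳ_; map; concat; concatMap; filter; foldr; length)
open import Data.List.Properties using (concat-map-[_])
import Data.List.Extrema as Extrema
open import Data.List.Membership.Propositional using (_∈_)
open import Data.List.Membership.Propositional.Properties
  using (∈-∃++; ∈-map⁺; ∈-concatMap⁺; ∈-filter⁺)
open import Data.List.Relation.Binary.Permutation.Propositional
  using (_↭_; ↭-refl; ↭-sym; ↭-trans; ↭-reflexive; prep)
open import Data.List.Relation.Binary.Permutation.Propositional.Properties
  using (∈-resp-↭; drop-mid; shift; ↭-empty-inv)
open import Data.List.Relation.Unary.All as All using (All; []; _∷_)
import Data.List.Relation.Unary.All.Properties as All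
open import Data.List.Relation.Unary.Any using (here; there)
import Data.List.Relation.Unary.Any as Any
open import Data.Nat.Base as ℕ using (ℕ)
import Data.Nat.Properties as ℕ
open import Data.Product.Base using (Σ; ∃; _×_; _,_; proj₁; proj₂)
open import Data.Rational.Base using (ℚ; 0ℚ; 1ℚ; _+_; _/_; _≤_; _<_)
import Data.Rational.Properties as ℚ
open import Data.Vec.Base as Vec using (Vec; lookup; replicate)
import Data.Vec.Relation.Unary.All as VecAll
import Data.Vec.Relation.Unary.All.Properties as VecAll
open import Level using (0ℓ)
open import Relation.Binary.PropositionalEquality using (_≡_; _≢_; refl; subst; sym)
open import Relation.Nullary using (Dec; contradiction; recompute)
open import Relation.Nullary.Decidable using (_×-dec_)
open import Relation.Unary using (Pred; _⊆_)

-- The fields after `size` are irrelevant, so an item is just its vector.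
record Item (d : ℕ) : Set where
  constructor mkItem
  field
    size      : Vec ℚ d
    .inCube   : VecAll.All (λ q → 0ℚ ≤ q × q ≤ 1ℚ) size
    .nonZero  : size ≢ replicate d 0ℚ

open Item public

Bin : ℕ → Set
Bin d = List (Item d)

module _ {d : ℕ} where

  load : Bin d → Fin d → ℚ
  load b j = foldr _+_ 0ℚ (map (λ x → lookup (size x) j) b)

  Fits : Bin d → Set
  Fits b = ∀ j → load b j ≤ 1ℚ

  fits? : (b : Bin d) → Dec (Fits b)
  fits? b = all? (λ j → load b j ℚ.≤? 1ℚ)

  record IsPacking (L : List (Item d)) (bins : List (Bin d)) : Set where
    field
      partition : concat bins ↭ L
      nonEmpty  : All (_≢ []) bins
      feasible  : All Fits bins

  open IsPacking public

  record IsOptimal (L : List (Item d)) (bins : List (Bin d)) : Set where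
    field
      isPacking : IsPacking L bins
      minimal   : ∀ bins′ → IsPacking L bins′ → length bins ℕ.≤ length bins′

  open IsOptimal public

  item-inCube : (x : Item d) → VecAll.All (λ q → 0ℚ ≤ q × q ≤ 1ℚ) (size x)
  item-inCube (mkItem v c _) =
    recompute (VecAll.all? (λ q → (0ℚ ℚ.≤? q) ×-dec (q ℚ.≤? 1ℚ)) v) c

  fits-[_] : (x : Item d) → Fits [ x ]
  fits-[ x ] j = subst (_≤ 1ℚ) (sym (ℚ.+-identityʳ _))
    (proj₂ (VecAll.lookup⁺ (item-inCube x) j))

  singletons-isPacking : (L : List (Item d)) → IsPacking L (map [_] L)
  singletons-isPacking L = record
    { partition = ↭-reflexive (concat-map-[ L ])
    ; nonEmpty  = All.map⁺ (All.universal (λ _ ()) L)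
    ; feasible  = All.map⁺ (All.universal fits-[_] L)
    }

-- All partitions of a list, obtained by cutting each of its rearrangements
-- into non-empty segments; used only to show that an optimal packing exists.
module Enumeration {A : Set} where

  Partition : List A → Pred (List (List A)) 0ℓ
  Partition xs bs = concat bs ↭ xs × All (_≢ []) bs

  insertions : A → List A → List (List A)
  insertions x []       = [ [ x ] ]
  insertions x (y ∷ ys) = (x ∷ y ∷ ys) ∷ map (y ∷_) (insertions x ys)

  permutations : List A → List (List A)
  permutations []       = [ [] ]
  permutations (x ∷ xs) = concatMap (insertions x) (permutations xs)

  extend : A → List (List A) → List (List (List A))
  extend x []       = [ [ [ x ] ] ]
  extend x (b ∷ bs) = ([ x ] ∷ b ∷ bs) ∷ ((x ∷ b) ∷ bs) ∷ []

  divisions : List A → List (List (List A))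
  divisions []       = [ [] ]
  divisions (x ∷ xs) = concatMap (extend x) (divisions xs)

  partitions : List A → List (List (List A))
  partitions xs = concatMap divisions (permutations xs)

  module _ {B C : Set} {P : Pred B 0ℓ} {Q : Pred C 0ℓ} {f : B → List C} where
    All-concatMap⁺ : (∀ {x} → P x → All Q (f x)) → ∀ {xs} → All P xs → All Q (concatMap f xs)
    All-concatMap⁺ g ps = All.concat⁺ (All.map⁺ (All.map g ps))

  ∈-concatMap : {B C : Set} (f : B → List C) {x : B} {y : C} {xs : List B} →
                x ∈ xs → y ∈ f x → y ∈ concatMap f xs
  ∈-concatMap f x∈xs y∈fx = ∈-concatMap⁺ f (Any.map (λ { refl → y∈fx }) x∈xs)

  insertions-sound : ∀ x ys → All (_↭ x ∷ ys) (insertions x ys)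
  insertions-sound x []       = ↭-refl ∷ []
  insertions-sound x (y ∷ ys) = ↭-refl ∷
    All.map⁺ (All.map (λ p → ↭-trans (prep y p) (shift x [ y ] ys)) (insertions-sound x ys))

  permutations-sound : ∀ xs → All (_↭ xs) (permutations xs)
  permutations-sound []       = ↭-refl ∷ []
  permutations-sound (x ∷ xs) = All-concatMap⁺
    (λ {ys} p → All.map (λ q → ↭-trans q (prep x p)) (insertions-sound x ys))
    (permutations-sound xs)

  Division : List A → Pred (List (List A)) 0ℓ
  Division xs bs = concat bs ≡ xs × All (_≢ []) bs

  extend-sound : ∀ x {xs} {bs} → Division xs bs → All (Division (x ∷ xs)) (extend x bs)
  extend-sound x {bs = []}     (refl , [])     = (refl , (λ ()) ∷ []) ∷ []
  extend-sound x {bs = b ∷ bs} (refl , p ∷ ps) =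
    (refl , (λ ()) ∷ p ∷ ps) ∷ (refl , (λ ()) ∷ ps) ∷ []

  divisions-sound : ∀ xs → All (Division xs) (divisions xs)
  divisions-sound []       = (refl , []) ∷ []
  divisions-sound (x ∷ xs) = All-concatMap⁺ (extend-sound x) (divisions-sound xs)

  partitions-sound : ∀ xs → All (Partition xs) (partitions xs)
  partitions-sound xs = All-concatMap⁺
    (λ {ys} p → All.map (λ { (refl , ne) → p , ne }) (divisions-sound ys))
    (permutations-sound xs)

  insertions-complete : ∀ x as bs → (as ++ x ∷ bs) ∈ insertions x (as ++ bs)
  insertions-complete x []       []       = here refl
  insertions-complete x []       (b ∷ bs) = here refl
  insertions-complete x (a ∷ as) bs       = there (∈-map⁺ (a ∷_) (insertions-complete x as bs))

  permutations-complete : ∀ xs {ys} → ys ↭ xs → ys ∈ permutations xs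
  permutations-complete [] p with refl ← ↭-empty-inv p = here refl
  permutations-complete (x ∷ xs) p
    with as , bs , refl ← ∈-∃++ (∈-resp-↭ (↭-sym p) (here refl)) =
    ∈-concatMap (insertions x) (permutations-complete xs (drop-mid as [] p))
      (insertions-complete x as bs)

  divisions-complete : ∀ bs → All (_≢ []) bs → bs ∈ divisions (concat bs)
  divisions-complete []                   []       = here refl
  divisions-complete ([] ∷ bs)            (p ∷ _)  = contradiction refl p
  divisions-complete ((x ∷ []) ∷ [])      (_ ∷ []) = here refl
  divisions-complete ((x ∷ []) ∷ b ∷ bs)  (_ ∷ ps) =
    ∈-concatMap (extend x) (divisions-complete (b ∷ bs) ps) (here refl)
  divisions-complete ((x ∷ y ∷ b) ∷ bs)   (_ ∷ ps) =
    ∈-concatMap (extend x) (divisions-complete ((y ∷ b) ∷ bs) ((λ ()) ∷ ps)) (there (here refl))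

  partitions-complete : ∀ {xs bs} → Partition xs bs → bs ∈ partitions xs
  partitions-complete {xs} {bs} (p , ne) =
    ∈-concatMap divisions (permutations-complete xs p) (divisions-complete bs ne)

module _ {d : ℕ} where

  open Enumeration {Item d}
  open Extrema ℕ.≤-totalOrder

  optimal : (L : List (Item d)) → ∃ (IsOptimal L)
  optimal L = argmin length (map [_] L) packings , record
    { isPacking = argmin-all length (singletons-isPacking L) packings-sound
    ; minimal   = λ bins′ p → All.lookup (f[argmin]≤f[xs] {f = length} (map [_] L) packings)
        (∈-filter⁺ (All.all? fits?) (partitions-complete (partition p , nonEmpty p)) (feasible p))
    }
    where
    packings : List (List (Bin d))
    packings = filter (All.all? fits?) (partitions L)

    packings-sound : All (IsPacking L) packings
    packings-sound = All.map
      (λ { (fs , p , ne) → record { partition = p ; nonEmpty = ne ; feasible = fs } })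
      (All.zip (All.all-filter (All.all? fits?) (partitions L)
               , All.filter⁺ (All.all? fits?) (partitions-sound L)))

  OPT : List (Item d) → ℕ
  OPT L = length (proj₁ (optimal L))

-- `Place x bins bins′`: bins′ results from bins by putting x into one of
-- them, or into a new bin appended at the end.
data Place {d : ℕ} (x : Item d) : List (Bin d) → List (Bin d) → Set where
  newBin   : Place x [] [ [ x ] ]
  thisBin  : ∀ {b bs} → Place x (b ∷ bs) ((x ∷ b) ∷ bs)
  laterBin : ∀ {b bs bs′} → Place x bs bs′ → Place x (b ∷ bs) (b ∷ bs′)

-- `bins L` is the packing held after the items of L have been presented, in
-- list order.  It is a function of L alone, and `step` relates the packings of
-- L and of L followed by x, so placing x uses no knowledge of later items and
-- no earlier item is ever moved.
record OnlineAlgorithm (d : ℕ) : Set where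
  field
    bins     : List (Item d) → List (Bin d)
    start    : bins [] ≡ []
    step     : ∀ L x → Place x (bins L) (bins (L ∷ʳ x))
    feasible : ∀ L → All Fits (bins L)

  cost : List (Item d) → ℕ
  cost L = length (bins L)

-- An extended real x ∈ [-∞,∞], given by the rationals strictly above it.
record ℝ∞ : Set₁ where
  field
    Above   : Pred ℚ 0ℓ
    upward  : ∀ {p q} → p < q → Above p → Above q
    rounded : ∀ {q} → Above q → ∃ λ p → p < q × Above p

infix 4 _<ᵣ_ _≤ᵣ_

_<ᵣ_ : ℝ∞ → ℚ → Set
x <ᵣ q = ℝ∞.Above x q

_≤ᵣ_ : ℝ∞ → ℝ∞ → Set
x ≤ᵣ y = ∀ q → y <ᵣ q → x <ᵣ q

sup : Pred ℚ 0ℓ → ℝ∞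
sup S = record
  { Above   = λ q → ∃ λ r → r < q × (∀ s → S s → s ≤ r)
  ; upward  = λ { p<q (r , r<p , ub) → r , ℚ.<-trans r<p p<q , ub }
  ; rounded = λ { (r , r<q , ub) → let p , r<p , p<q = ℚ.<-dense r<q
                                   in p , p<q , r , r<p , ub }
  }

sup-mono : ∀ {S T} → S ⊆ T → sup S ≤ᵣ sup T
sup-mono S⊆T q (r , r<q , ub) = r , r<q , λ s s∈S → ub s (S⊆T s∈S)

Antitone : (ℕ → ℝ∞) → Set
Antitone x = ∀ {m n} → m ℕ.≤ n → x n ≤ᵣ x m

-- Antitonicity guarantees that the limit exists.  It lies strictly below q
-- exactly when the sequence is eventually below some r < q.
lim : (x : ℕ → ℝ∞) → Antitone x → ℝ∞
lim x _ = record
  { Above   = λ q → ∃ λ r → r < q × ∃ λ N → ∀ n → N ℕ.≤ n → x n <ᵣ r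
  ; upward  = λ { p<q (r , r<p , ev) → r , ℚ.<-trans r<p p<q , ev }
  ; rounded = λ { (r , r<q , ev) → let p , r<p , p<q = ℚ.<-dense r<q
                                   in p , p<q , r , r<p , ev }
  }

module _ {d : ℕ} (A : OnlineAlgorithm d) where

  open OnlineAlgorithm A using (cost)

  -- The ratio is undefined for OPT(L) = 0, which is excluded; this only
  -- affects K = 0 and hence not the limit.
  Ratios : ℕ → Pred ℚ 0ℓ
  Ratios K q = ∃ λ L → K ℕ.≤ OPT L × Σ (ℕ.NonZero (OPT L)) λ nz →
    q ≡ ((+ cost L) / OPT L) {{nz}}

  Ratios-antitone : ∀ {K K′} → K ℕ.≤ K′ → Ratios K′ ⊆ Ratios K
  Ratios-antitone K≤K′ (L , K′≤OPT , q≡) = L , ℕ.≤-trans K≤K′ K′≤OPT , q≡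

  asymptoticCompetitiveRatio : ℝ∞
  asymptoticCompetitiveRatio =
    lim (λ K → sup (Ratios K)) (λ K≤K′ → sup-mono (Ratios-antitone K≤K′))

{-# OPTIONS --safe #-}

-- The adversary forces ratio 3 − 1/s in dimension s + 2, here with s = 6.
-- Weights are so small and so widely spread that each item can be declared
-- "large" or "small" after the algorithm has placed it: a later item leaving
-- room τ in that coordinate fits together with many small items but with no
-- large one.  With n = s m, the input consists of
--   * n k tiny items, k of them filling a bin; those opening a bin are large,
--     so the X ≥ n bins in use are closed to all later items;
--   * for each i ≤ s, n middle items of type i, pairwise in conflict; one is
--     declared large if its bin has no large middle item yet, up to m per type.
--     Either this quota is met or all n items of the type lie in bins with a
--     large item, so in the end at least n bins with a large middle item exist;
--   * (s − 1) m big items, in conflict with each other and with every large item.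
-- The algorithm uses at least X + n + (s − 1) m bins.  Offline, (s − 1) m bins
-- hold a big item and a small middle item of each type, m bins hold the other
-- middle items, all these n bins are filled up with small tiny items, and the
-- X large tiny items need only X / k + 1 further bins.
module Submission where

open import Defs
open import Data.Fin.Base as Fin using (Fin; zero; suc; toℕ)
import Data.Fin.Properties as Fin
open import Data.Integer.Base as ℤ using (+_)
import Data.Integer.Properties as ℤ
open import Data.List.Base
  using (List; []; _∷_; [_]; _++_; _∷ʳ_; map; concat; filter; length; take; drop; zipWith; replicate)
open import Data.List.Properties
  using (map-++; length-map; length-++; length-take; length-drop; length-filter; length-replicate;
         length-zipWith; take++drop≡id; filter-all; ++-assoc; concat-++; concat-map)
open import Data.List.Relation.Binary.Permutation.Propositional
  using (_↭_; ↭-refl; ↭-sym; ↭-trans; ↭-reflexive; prep; swap; module PermutationReasoning)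
import Data.List.Relation.Binary.Permutation.Propositional.Properties as ↭
open import Data.List.Relation.Unary.All as All using (All; []; _∷_)
import Data.List.Relation.Unary.All.Properties as All
open import Data.List.Relation.Unary.Any as Any using (Any; here; there; any?)
open import Data.Nat.Base as ℕ using (ℕ; zero; suc; NonZero; _+_; _*_; _∸_; _≤_; _<_; z≤n; s≤s)
open import Data.Nat.DivMod using (m≡m%n+[m/n]*n; m%n<n; m/n*n≤m) renaming (_/_ to _div_)
open import Data.Nat.ListAction using (sum)
open import Data.Nat.ListAction.Properties using (sum-++; sum-↭)
import Data.Nat.Properties as ℕ
open import Data.Nat.Solver using (module +-*-Solver)
open import Data.Product.Base using (∃; _×_; _,_; proj₂)
open import Data.Rational.Base as ℚ using (ℚ; 0ℚ; 1ℚ; _/_; toℚᵘ)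
import Data.Rational.Properties as ℚ
open import Data.Rational.Unnormalised.Base as ℚᵘ using (mkℚᵘ; *≡*; *≤*)
import Data.Rational.Unnormalised.Properties as ℚᵘ
open import Data.Sum.Base using (_⊎_; inj₁; inj₂)
open import Data.Vec.Base using (lookup; tabulate)
import Data.Vec.Properties as Vec
import Data.Vec.Relation.Unary.All.Properties as VecAll
open import Function.Base using (_∘_; id)
open import Level using (0ℓ)
open import Relation.Binary.PropositionalEquality hiding ([_])
open import Relation.Nullary using (¬_; Dec; yes; no; contradiction)
open import Relation.Unary using (Pred; Decidable)

private variable
  d : ℕ

-- Fractions of natural numbers, and loads of bins.

toℚᵘ-/ : ∀ a b → toℚᵘ (+ a / suc b) ℚᵘ.≃ mkℚᵘ (+ a) b
toℚᵘ-/ a b = ℚ.toℚᵘ-fromℚᵘ (mkℚᵘ (+ a) b)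

/-mono-≤ : ∀ a b c d .{{_ : NonZero b}} .{{_ : NonZero d}} →
           a * d ≤ c * b → (+ a / b) ℚ.≤ (+ c / d)
/-mono-≤ a (suc b) c (suc d) le = ℚ.toℚᵘ-cancel-≤
  (ℚᵘ.≤-respʳ-≃ (ℚᵘ.≃-sym (toℚᵘ-/ c d)) (ℚᵘ.≤-respˡ-≃ (ℚᵘ.≃-sym (toℚᵘ-/ a b))
    (*≤* (subst₂ ℤ._≤_ (ℤ.pos-* a (suc d)) (ℤ.pos-* c (suc b)) (ℤ.+≤+ le)))))

/-cancel-≤ : ∀ a b c d .{{_ : NonZero b}} .{{_ : NonZero d}} →
             (+ a / b) ℚ.≤ (+ c / d) → a * d ≤ c * b
/-cancel-≤ a (suc b) c (suc d) le
  with *≤* le′ ← ℚᵘ.≤-respʳ-≃ (toℚᵘ-/ c d) (ℚᵘ.≤-respˡ-≃ (toℚᵘ-/ a b) (ℚ.toℚᵘ-mono-≤ le)) =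
  ℤ.drop‿+≤+ (subst₂ ℤ._≤_ (sym (ℤ.pos-* a (suc d))) (sym (ℤ.pos-* c (suc b))) le′)

/-cancel-< : ∀ a b c d .{{_ : NonZero b}} .{{_ : NonZero d}} →
             (+ a / b) ℚ.< (+ c / d) → a * d < c * b
/-cancel-< a b c d lt = ℕ.≰⇒> λ le → ℚ.<-irrefl refl (ℚ.<-≤-trans lt (/-mono-≤ c d a b le))

/-+ : ∀ a b d .{{_ : NonZero d}} → (+ a / d) ℚ.+ (+ b / d) ≡ + (a + b) / d
/-+ a b (suc d) = ℚ.toℚᵘ-injective (begin-equality
  toℚᵘ ((+ a / suc d) ℚ.+ (+ b / suc d))         ≃⟨ ℚ.toℚᵘ-homo-+ (+ a / suc d) (+ b / suc d) ⟩
  toℚᵘ (+ a / suc d) ℚᵘ.+ toℚᵘ (+ b / suc d)     ≃⟨ ℚᵘ.+-cong (toℚᵘ-/ a d) (toℚᵘ-/ b d) ⟩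
  mkℚᵘ (+ a) d ℚᵘ.+ mkℚᵘ (+ b) d                 ≃⟨ *≡* eq ⟩
  mkℚᵘ (+ (a + b)) d                             ≃⟨ toℚᵘ-/ (a + b) d ⟨
  toℚᵘ (+ (a + b) / suc d)                       ∎)
  where
  open ℚᵘ.≤-Reasoning
  eq : (+ a ℤ.* + suc d ℤ.+ + b ℤ.* + suc d) ℤ.* + suc d ≡ + (a + b) ℤ.* (+ (suc d * suc d))
  eq = trans (cong (ℤ._* + suc d) (sym (ℤ.*-distribʳ-+ (+ suc d) (+ a) (+ b))))
    (trans (ℤ.*-assoc (+ (a + b)) (+ suc d) (+ suc d))
           (cong (+ (a + b) ℤ.*_) (sym (ℤ.pos-* (suc d) (suc d)))))

0/ : ∀ d .{{_ : NonZero d}} → + 0 / d ≡ 0ℚ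
0/ (suc d) = ℚ.toℚᵘ-injective (ℚᵘ.≃-trans (toℚᵘ-/ 0 d) (*≡* refl))

module _ {d : ℕ} where

  load-++ : ∀ (b c : Bin d) j → load (b ++ c) j ≡ load b j ℚ.+ load c j
  load-++ []      c j = sym (ℚ.+-identityˡ _)
  load-++ (x ∷ b) c j = trans (cong (lookup (size x) j ℚ.+_) (load-++ b c j))
                              (sym (ℚ.+-assoc (lookup (size x) j) _ _))

  load-↭ : ∀ {b c : Bin d} → b ↭ c → ∀ j → load b j ≡ load c j
  load-↭ _↭_.refl j = refl
  load-↭ (prep x p) j = cong (lookup (size x) j ℚ.+_) (load-↭ p j)
  load-↭ (swap {xs} {ys} x y p) j = begin
    u ℚ.+ (v ℚ.+ load xs j) ≡⟨ ℚ.+-assoc u v _ ⟨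
    (u ℚ.+ v) ℚ.+ load xs j ≡⟨ cong₂ ℚ._+_ (ℚ.+-comm u v) (load-↭ p j) ⟩
    (v ℚ.+ u) ℚ.+ load ys j ≡⟨ ℚ.+-assoc v u _ ⟩
    v ℚ.+ (u ℚ.+ load ys j) ∎
    where
    open ≡-Reasoning
    u = lookup (size x) j
    v = lookup (size y) j
  load-↭ (_↭_.trans p q) j = trans (load-↭ p j) (load-↭ q j)

  load-concat : ∀ {bs : List (Bin d)} → All Fits bs → ∀ j → load (concat bs) j ℚ.≤ + length bs / 1
  load-concat []                         j = ℚ.≤-reflexive (sym (0/ 1))
  load-concat {b ∷ bs} (fits ∷ fs) j = begin
    load (b ++ concat bs) j       ≡⟨ load-++ b (concat bs) j ⟩
    load b j ℚ.+ load (concat bs) j ≤⟨ ℚ.+-mono-≤ (fits j) (load-concat fs j) ⟩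
    1ℚ ℚ.+ (+ length bs / 1)     ≡⟨ /-+ 1 (length bs) 1 ⟩
    + suc (length bs) / 1        ∎
    where open ℚ.≤-Reasoning

-- Placing an element into one of several bins.

-- The index b is the bin that x joins; it is [] when x opens a new bin.
data Put {A : Set} (x : A) : List A → List (List A) → List (List A) → Set where
  new   : Put x [] [] [ [ x ] ]
  this  : ∀ {b bs} → Put x b (b ∷ bs) ((x ∷ b) ∷ bs)
  later : ∀ {b c bs bs′} → Put x b bs bs′ → Put x b (c ∷ bs) (c ∷ bs′)

module _ {A : Set} {x : A} where

  Put-concat : ∀ {b bs bs′} → Put x b bs bs′ → concat bs′ ↭ x ∷ concat bs
  Put-concat new  = ↭-refl
  Put-concat this = ↭-refl
  Put-concat (later {c = c} {bs} {bs′} p) =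
    ↭-trans (↭.++⁺ˡ c (Put-concat p)) (↭.shift x c (concat bs))

  Put-All : ∀ {P Q : Pred (List A) 0ℓ} {b bs bs′} → Put x b bs bs′ →
            (∀ {c} → P c → Q c) → Q (x ∷ b) → All P bs → All Q bs′
  Put-All new       f q ps       = q ∷ []
  Put-All this      f q (p ∷ ps) = q ∷ All.map f ps
  Put-All (later i) f q (p ∷ ps) = f p ∷ Put-All i f q ps

  Put-target : ∀ {P : Pred (List A) 0ℓ} {b bs bs′} → Put x b bs bs′ → All P bs′ → P (x ∷ b)
  Put-target new       (p ∷ _)  = p
  Put-target this      (p ∷ _)  = p
  Put-target (later i) (_ ∷ ps) = Put-target i ps

  Put-source : ∀ {P : Pred (List A) 0ℓ} {b bs bs′} → Put x b bs bs′ → P [] → All P bs → P b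
  Put-source new       p₀ _        = p₀
  Put-source this      _  (p ∷ _)  = p
  Put-source (later i) p₀ (_ ∷ ps) = Put-source i p₀ ps

Place⇒Put : ∀ {x : Item d} {bs bs′} → Place x bs bs′ → ∃ λ b → Put x b bs bs′
Place⇒Put newBin       = [] , new
Place⇒Put thisBin      = _ , this
Place⇒Put (laterBin p) = let b , i = Place⇒Put p in b , later i

module _ {A B : Set} (f : A → B) where

  Put-map⁻ : ∀ x bs {bs′} {c} → Put (f x) c (map (map f) bs) bs′ →
             ∃ λ cs′ → ∃ λ b → Put x b bs cs′ × bs′ ≡ map (map f) cs′
  Put-map⁻ x []       new       = _ , _ , new , refl
  Put-map⁻ x (b ∷ bs) this      = _ , _ , this , refl
  Put-map⁻ x (b ∷ bs) (later i) with _ , _ , i′ , refl ← Put-map⁻ x bs i = _ , _ , later i′ , refl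


-- Items given by natural weights over a common denominator.

-- Weights are numerators over `D`, which moves all later arithmetic to ℕ. `axis` witnesses that the
-- vector is not zero.
record Piece (d D : ℕ) : Set where
  field
    weight   : Fin d → ℕ
    weight≤D : ∀ j → weight j ≤ D
    axis     : Fin d
    axis>0   : 0 < weight axis

open Piece

module _ {d D : ℕ} where

  total : Fin d → List (Piece d D) → ℕ
  total j b = sum (map (λ w → weight w j) b)

  FitsWithin : List (Piece d D) → Set
  FitsWithin b = ∀ j → total j b ≤ D

  total-++ : ∀ j b c → total j (b ++ c) ≡ total j b + total j c
  total-++ j b c = trans (cong sum (map-++ (λ w → weight w j) b c)) (sum-++ (map _ b) (map _ c))

  total-↭ : ∀ j {b c} → b ↭ c → total j b ≡ total j c
  total-↭ j p = sum-↭ (↭.map⁺ (λ w → weight w j) p)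

  total-≤ : ∀ j {v} {b} → All (λ w → weight w j ≤ v) b → total j b ≤ length b * v
  total-≤ j []       = z≤n
  total-≤ j (p ∷ ps) = ℕ.+-mono-≤ p (total-≤ j ps)

  total-≥ : ∀ j {v} {b} → All (λ w → v ≤ weight w j) b → length b * v ≤ total j b
  total-≥ j []       = z≤n
  total-≥ j (p ∷ ps) = ℕ.+-mono-≤ p (total-≥ j ps)

  Any⇒≤total : ∀ j {v} {b} → Any (λ w → v ≤ weight w j) b → v ≤ total j b
  Any⇒≤total j (here p)              = ℕ.m≤n⇒m≤n+o _ p
  Any⇒≤total j {b = w ∷ _} (there a) = ℕ.m≤n⇒m≤o+n (weight w j) (Any⇒≤total j a)

module Scaled {d : ℕ} (D : ℕ) {{D≢0 : NonZero D}} where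

  opaque

    item : Piece d D → Item d
    item w = mkItem (tabulate λ j → + weight w j / D)
      (VecAll.tabulate⁺ λ j →
        subst (ℚ._≤ (+ weight w j / D)) (0/ D) (/-mono-≤ 0 D (weight w j) D z≤n) ,
        /-mono-≤ (weight w j) D 1 1
          (ℕ.≤-trans (ℕ.≤-reflexive (ℕ.*-identityʳ _))
            (ℕ.≤-trans (weight≤D w j) (ℕ.≤-reflexive (sym (ℕ.*-identityˡ D))))))
      λ eq → ℕ.<⇒≱ (axis>0 w) (subst (_≤ 0) (ℕ.*-identityʳ _)
        (/-cancel-≤ (weight w (axis w)) D 0 1 (ℚ.≤-reflexive
          (trans (sym (Vec.lookup∘tabulate _ (axis w)))
            (trans (cong (λ v → lookup v (axis w)) eq)
              (trans (Vec.lookup-replicate (axis w) 0ℚ) (sym (0/ 1))))))))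

    load-item : ∀ b j → load (map item b) j ≡ + total j b / D
    load-item []      j = sym (0/ D)
    load-item (w ∷ b) j =
      trans (cong₂ ℚ._+_ (Vec.lookup∘tabulate _ j) (load-item b j)) (/-+ (weight w j) (total j b) D)

  Fits⇒FitsWithin : ∀ {b} → Fits (map item b) → FitsWithin b
  Fits⇒FitsWithin {b} fits j = subst₂ _≤_ (ℕ.*-identityʳ _) (ℕ.*-identityˡ D)
    (/-cancel-≤ (total j b) D 1 1 (subst (ℚ._≤ 1ℚ) (load-item b j) (fits j)))

  FitsWithin⇒Fits : ∀ {b} → FitsWithin b → Fits (map item b)
  FitsWithin⇒Fits {b} fits j = subst (ℚ._≤ 1ℚ) (sym (load-item b j))
    (/-mono-≤ (total j b) D 1 1 (subst₂ _≤_ (sym (ℕ.*-identityʳ _)) (sym (ℕ.*-identityˡ D)) (fits j)))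

  -- Each bin contributes at most 1. For an optimal packing this bounds `OPT` from below, for the
  -- algorithm's bins their number.
  volume : ∀ {ws bs} → concat bs ↭ map item ws → All Fits bs → ∀ j → total j ws ≤ length bs * D
  volume {ws} {bs} p fs j = subst (_≤ _) (ℕ.*-identityʳ _)
    (/-cancel-≤ (total j ws) D (length bs) 1
      (subst (ℚ._≤ _) (trans (load-↭ p j) (load-item ws j)) (load-concat fs j)))

  OPT-≥ : ∀ ws j v → v * D ≤ total j ws → v ≤ OPT (map item ws)
  OPT-≥ ws j v le = ℕ.*-cancelʳ-≤ v _ D
    (ℕ.≤-trans le (volume (partition p) (IsPacking.feasible p) j))
    where p = isPacking (proj₂ (optimal (map item ws)))

  -- The proposed bins may be empty, as those cut by `chunks` can be. Dropping the empty ones leaves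
  -- a packing with no more bins.
  OPT-≤ : ∀ ws bs → concat bs ↭ ws → All FitsWithin bs → OPT (map item ws) ≤ length bs
  OPT-≤ ws bs p fs = begin
    OPT (map item ws)        ≤⟨ minimal (proj₂ (optimal (map item ws))) bs′ isPacking′ ⟩
    length bs′               ≤⟨ length-filter nonEmpty? (map (map item) bs) ⟩
    length (map (map item) bs) ≡⟨ length-map (map item) bs ⟩
    length bs                ∎
    where
    open ℕ.≤-Reasoning

    nonEmpty? : (b : Bin d) → Dec (b ≢ [])
    nonEmpty? []      = no λ ne → ne refl
    nonEmpty? (_ ∷ _) = yes λ ()

    bs′ : List (Bin d)
    bs′ = filter nonEmpty? (map (map item) bs)

    concat-filter : ∀ cs → concat (filter nonEmpty? cs) ≡ concat cs
    concat-filter []             = refl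
    concat-filter ([] ∷ cs)      = concat-filter cs
    concat-filter ((x ∷ c) ∷ cs) = cong ((x ∷ c) ++_) (concat-filter cs)

    isPacking′ : IsPacking (map item ws) bs′
    isPacking′ = record
      { partition = ↭-trans (↭-reflexive (trans (concat-filter (map (map item) bs)) (concat-map bs)))
                            (↭.map⁺ item p)
      ; nonEmpty  = All.all-filter nonEmpty? (map (map item) bs)
      ; feasible  = All.filter⁺ nonEmpty? (All.map⁺ (All.map (λ {b} → FitsWithin⇒Fits {b}) fs))
      }

  -- Playing against an online algorithm.

  module _ (A : OnlineAlgorithm d) where
    open OnlineAlgorithm A renaming (feasible to bins-fit)

    -- `held` is the algorithm's packing lifted from items to pieces, so that the adversary can read
    -- the weights in each bin and react to them.
    record Run : Set where
      field
        seq      : List (Piece d D)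
        held     : List (List (Piece d D))
        linked   : bins (map item seq) ≡ map (map item) held
        contents : concat held ↭ seq

    open Run

    startRun : Run
    startRun = record { seq = [] ; held = [] ; linked = start ; contents = ↭-refl }

    run-fits : ∀ σ → All FitsWithin (held σ)
    run-fits σ = All.map (λ {b} → Fits⇒FitsWithin {b})
      (All.map⁻ (subst (All Fits) (linked σ) (bins-fit (map item (seq σ)))))

    run-cost : ∀ σ → cost (map item (seq σ)) ≡ length (held σ)
    run-cost σ = trans (cong length (linked σ)) (length-map (map item) (held σ))

    run-volume : ∀ σ j → total j (seq σ) ≤ length (held σ) * D
    run-volume σ j = subst (λ l → total j (seq σ) ≤ l * D) (length-map (map item) (held σ))
      (volume (↭-trans (↭-reflexive (concat-map (held σ))) (↭.map⁺ item (contents σ)))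
        (All.map⁺ (All.map (λ {b} → FitsWithin⇒Fits {b}) (run-fits σ))) j)

    record Response (σ : Run) (w : Piece d D) : Set where
      field
        target : List (Piece d D)
        after  : Run
        put    : Put w target (held σ) (held after)
        seq↭   : seq after ↭ w ∷ seq σ

      target-fits : FitsWithin (w ∷ target)
      target-fits = Put-target put (run-fits after)

    present : ∀ σ w → Response σ w
    present σ w = respond (Place⇒Put (step (map item (seq σ)) (item w)))
      where
      respond : (∃ λ b → Put (item w) b (bins (map item (seq σ))) (bins (map item (seq σ) ∷ʳ item w))) →
                Response σ w
      respond (b , i)
        with held′ , b′ , i′ , eq ←
          Put-map⁻ item w (held σ) (subst (λ bs → Put (item w) b bs (bins (map item (seq σ) ∷ʳ item w))) (linked σ) i) = record
        { target = b′
        ; after  = record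
          { seq      = seq σ ∷ʳ w
          ; held     = held′
          ; linked   = trans (cong bins (map-++ item (seq σ) [ w ])) eq
          ; contents = ↭-trans (Put-concat i′) (↭-trans (prep w (contents σ)) (↭.∷↭∷ʳ w (seq σ)))
          }
        ; put  = i′
        ; seq↭ = ↭-sym (↭.∷↭∷ʳ w (seq σ))
        }

-- Counting bins across a placement; cutting lists into bins.

module _ {A : Set} where

  -- Tells opening a bin from joining one by the number of bins. In the second case the target is an
  -- old bin and has every property that all old bins share.
  Put-case : ∀ {x : A} {b bs bs′} → Put x b bs bs′ →
             length bs′ ≡ suc (length bs) ⊎
             (length bs′ ≡ length bs × ∀ {P : Pred (List A) 0ℓ} → All P bs → P b)
  Put-case new  = inj₁ refl
  Put-case this = inj₂ (refl , λ { (p ∷ _) → p })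
  Put-case (later i) with Put-case i
  ... | inj₁ eq       = inj₁ (cong suc eq)
  ... | inj₂ (eq , f) = inj₂ (cong suc eq , λ { (_ ∷ ps) → f ps })

  module _ {P Q : Pred (List A) 0ℓ} (P? : Decidable P) (Q? : Decidable Q) where

    private
      #P #Q : List (List A) → ℕ
      #P bs = length (filter P? bs)
      #Q bs = length (filter Q? bs)

    filter-mono-≤ : ∀ {bs} → All (λ b → P b → Q b) bs → #P bs ≤ #Q bs
    filter-mono-≤ [] = z≤n
    filter-mono-≤ {b ∷ bs} (f ∷ fs) with P? b | Q? b
    ... | yes p | no ¬q = contradiction (f p) ¬q
    ... | yes _ | yes _ = s≤s (filter-mono-≤ fs)
    ... | no  _ | yes _ = ℕ.m≤n⇒m≤1+n (filter-mono-≤ fs)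
    ... | no  _ | no  _ = filter-mono-≤ fs

    module _ {x : A} (f : ∀ {c} → P c → Q c) where

      -- `P` counts before the step and `Q` after it, to allow for a threshold that drops during the
      -- step.
      filter-put-≤ : ∀ {b bs bs′} → Put x b bs bs′ → (P b → Q (x ∷ b)) → #P bs ≤ #Q bs′
      filter-put-≤ new g = z≤n
      filter-put-≤ (this {b} {bs}) g with P? b | Q? (x ∷ b)
      ... | yes p | no ¬q = contradiction (g p) ¬q
      ... | yes _ | yes _ = s≤s (filter-mono-≤ (All.universal (λ _ → f) bs))
      ... | no  _ | yes _ = ℕ.m≤n⇒m≤1+n (filter-mono-≤ (All.universal (λ _ → f) bs))
      ... | no  _ | no  _ = filter-mono-≤ (All.universal (λ _ → f) bs)
      filter-put-≤ (later {c = c} i) g with P? c | Q? c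
      ... | yes p | no ¬q = contradiction (f p) ¬q
      ... | yes _ | yes _ = s≤s (filter-put-≤ i g)
      ... | no  _ | yes _ = ℕ.m≤n⇒m≤1+n (filter-put-≤ i g)
      ... | no  _ | no  _ = filter-put-≤ i g

      filter-put-< : ∀ {b bs bs′} → Put x b bs bs′ → ¬ P b → Q (x ∷ b) → #P bs < #Q bs′
      filter-put-< new ¬p q with Q? [ x ]
      ... | yes _ = s≤s z≤n
      ... | no ¬q = contradiction q ¬q
      filter-put-< (this {b} {bs}) ¬p q with P? b | Q? (x ∷ b)
      ... | yes p | _     = contradiction p ¬p
      ... | no  _ | no ¬q = contradiction q ¬q
      ... | no  _ | yes _ = s≤s (filter-mono-≤ (All.universal (λ _ → f) bs))
      filter-put-< (later {c = c} i) ¬p q with P? c | Q? c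
      ... | yes p | no ¬q = contradiction (f p) ¬q
      ... | yes _ | yes _ = s≤s (filter-put-< i ¬p q)
      ... | no  _ | yes _ = ℕ.m≤n⇒m≤1+n (filter-put-< i ¬p q)
      ... | no  _ | no  _ = filter-put-< i ¬p q

  ++-interchange : (as bs cs ds : List A) → (as ++ bs) ++ (cs ++ ds) ↭ (as ++ cs) ++ (bs ++ ds)
  ++-interchange as bs cs ds = ↭-trans (↭-reflexive (++-assoc as bs (cs ++ ds)))
    (↭-trans (↭.++⁺ˡ as (↭.shifts bs cs)) (↭-reflexive (sym (++-assoc as cs (bs ++ ds)))))

  onto : List A → List (List A) → List (List A)
  onto = zipWith _∷_

  concat-onto : ∀ xs bs → length xs ≡ length bs → concat (onto xs bs) ↭ xs ++ concat bs
  concat-onto []       []       eq = ↭-refl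
  concat-onto (x ∷ xs) (b ∷ bs) eq = prep x (↭-trans
    (↭.++⁺ˡ b (concat-onto xs bs (ℕ.suc-injective eq)))
    (↭.shifts b xs))

  onto-All : ∀ {P : Pred A 0ℓ} {Q R : Pred (List A) 0ℓ} → (∀ {x b} → P x → Q b → R (x ∷ b)) →
             ∀ {xs bs} → All P xs → All Q bs → All R (onto xs bs)
  onto-All f []       qs       = []
  onto-All f (p ∷ ps) []       = []
  onto-All f (p ∷ ps) (q ∷ qs) = f p q ∷ onto-All f ps qs

  length-onto : ∀ xs bs → length xs ≡ length bs → length (onto xs bs) ≡ length bs
  length-onto xs bs eq = trans (length-zipWith _∷_ xs bs)
    (trans (cong (ℕ._⊓ length bs) eq) (ℕ.⊓-idem _))

  -- There are always `n` chunks, the last ones short or empty when elements run out, so the number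
  -- of offline bins is known exactly.
  chunks : ℕ → ℕ → List A → List (List A)
  chunks k zero    xs = []
  chunks k (suc n) xs = take k xs ∷ chunks k n (drop k xs)

  length-chunks : ∀ k n xs → length (chunks k n xs) ≡ n
  length-chunks k zero    xs = refl
  length-chunks k (suc n) xs = cong suc (length-chunks k n (drop k xs))

  concat-chunks : ∀ k n xs → length xs ≤ n * k → concat (chunks k n xs) ≡ xs
  concat-chunks k zero    []  le = refl
  concat-chunks k (suc n) xs le = trans
    (cong (take k xs ++_) (concat-chunks k n (drop k xs)
      (subst (_≤ n * k) (sym (length-drop k xs)) (ℕ.m≤n+o⇒m∸n≤o (length xs) k le))))
    (take++drop≡id k xs)

  chunks-All : ∀ {P : Pred A 0ℓ} k n {xs} → All P xs →
               All (λ b → length b ≤ k × All P b) (chunks k n xs)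
  chunks-All k zero    ps = []
  chunks-All k (suc n) {xs} ps =
    (subst (_≤ k) (sym (length-take k xs)) (ℕ.m⊓n≤m k _) , All.take⁺ k ps) ∷
    chunks-All k n (All.drop⁺ k ps)

-- Bins that contain a heavy weight.

module _ {d D : ℕ} where

  Hit : Fin d → ℕ → List (Piece d D) → Set
  Hit j θ = Any (λ w → θ ≤ weight w j)

  hit? : ∀ j θ → Decidable (Hit j θ)
  hit? j θ = any? (λ w → θ ℕ.≤? weight w j)

  Hit-mono : ∀ {j θ θ′} → θ′ ≤ θ → ∀ {b} → Hit j θ b → Hit j θ′ b
  Hit-mono θ′≤θ = Any.map (ℕ.≤-trans θ′≤θ)

  hits : Fin d → ℕ → List (List (Piece d D)) → ℕ
  hits j θ bs = length (filter (hit? j θ) bs)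

  hits-≤ : ∀ {w b bs bs′} → Put w b bs bs′ → ∀ j {θ θ′} → θ′ ≤ θ → hits j θ bs ≤ hits j θ′ bs′
  hits-≤ i j θ′≤θ =
    filter-put-≤ (hit? j _) (hit? j _) (Hit-mono θ′≤θ) i (there ∘ Hit-mono θ′≤θ)

  hits-< : ∀ {w b bs bs′} → Put w b bs bs′ → ∀ j {θ θ′} → θ′ ≤ θ →
           ¬ Hit j θ b → θ′ ≤ weight w j → hits j θ bs < hits j θ′ bs′
  hits-< i j θ′≤θ ¬h le = filter-put-< (hit? j _) (hit? j _) (Hit-mono θ′≤θ) i ¬h (here le)

  -- The source of every conflict: it is applied to an item of weight `room lo` with `hi` as `θ`,
  -- the inequality being `D<room+hi`.
  fits⇒¬Hit : ∀ {w : Piece d D} {b} j {θ} → FitsWithin (w ∷ b) → D < weight w j + θ → ¬ Hit j θ b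
  fits⇒¬Hit {w} j fits lt h =
    ℕ.<⇒≱ lt (ℕ.≤-trans (ℕ.+-monoʳ-≤ (weight w j) (Any⇒≤total j h)) (fits j))

-- The scale of weights.

module Adversary (q k m : ℕ) (2≤k : 2 ≤ k) where

  s n g rounds : ℕ
  s = suc q
  n = s * m
  -- An offline bin receives at most `k` tiny and `s` middle items; one weight `g` times as large as
  -- `lo` exceeds `k + s` weights of at most `lo`.
  g = suc (k + s)
  rounds = s * n + n * k

  -- `width r` is `g` to the power `2 ^ r`. Because of the squaring, a factor `width r` remains
  -- between the ends of the gap whichever end the probe replaces.
  width : ℕ → ℕ
  width zero    = g
  width (suc r) = width r * width r

  width-≥1 : ∀ r → 1 ≤ width r
  width-≥1 zero    = s≤s z≤n
  width-≥1 (suc r) = ℕ.*-mono-≤ (width-≥1 r) (width-≥1 r)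

  width-≥g : ∀ r → g ≤ width r
  width-≥g zero    = ℕ.≤-refl
  width-≥g (suc r) = ℕ.≤-trans (width-≥g r)
    (ℕ.m≤n*m (width r) (width r) {{ℕ.>-nonZero (width-≥1 r)}})

  H unit D : ℕ
  H = width rounds
  -- Tiny items have size `1 / k` in coordinate zero. The factor `g` keeps `k + s` weights of at
  -- most `H` together below one `unit`.
  unit = g * H
  D = k * unit

  0<H : 0 < H
  0<H = width-≥1 rounds

  0<unit : 0 < unit
  0<unit = ℕ.*-mono-≤ {1} {g} (s≤s z≤n) 0<H

  H≤unit : H ≤ unit
  H≤unit = ℕ.m≤m+n H _

  unit+unit≤D : unit + unit ≤ D
  unit+unit≤D = ℕ.≤-trans (ℕ.≤-reflexive (cong (λ u → unit + u) (sym (ℕ.+-identityʳ unit))))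
                          (ℕ.*-monoˡ-≤ unit 2≤k)

  unit≤D : unit ≤ D
  unit≤D = ℕ.≤-trans (ℕ.m≤m+n unit unit) unit+unit≤D

  instance
    k≢0 : NonZero k
    k≢0 = ℕ.>-nonZero (ℕ.<-≤-trans (s≤s z≤n) 2≤k)

    D≢0 : NonZero D
    D≢0 = ℕ.>-nonZero (ℕ.<-≤-trans 0<unit unit≤D)

  -- While r rounds remain, every label below is a weight of at most lo or of
  -- at least hi.
  record Gap (r lo hi : ℕ) : Set where
    field
      lo>0 : 0 < lo
      hi≤H : hi ≤ H
      wide : width r * lo ≤ hi

  open Gap public

  -- The weight to present next; it may become the new lo or the new hi.
  probe : ℕ → ℕ → ℕ
  probe r lo = width r * lo

  lo≤probe : ∀ r lo → lo ≤ probe r lo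
  lo≤probe r lo = ℕ.m≤n*m lo (width r) {{ℕ.>-nonZero (width-≥1 r)}}

  module _ {r lo hi} (γ : Gap (suc r) lo hi) where

    probe-wide : width r * probe r lo ≤ hi
    probe-wide = ℕ.≤-trans (ℕ.≤-reflexive (sym (ℕ.*-assoc (width r) (width r) lo))) (wide γ)

    probe≤hi : probe r lo ≤ hi
    probe≤hi = ℕ.≤-trans (lo≤probe r (probe r lo)) probe-wide

    raise : Gap r (probe r lo) hi
    raise = record { lo>0 = ℕ.<-≤-trans (lo>0 γ) (lo≤probe r lo) ; hi≤H = hi≤H γ ; wide = probe-wide }

    lower : Gap r lo (probe r lo)
    lower = record { lo>0 = lo>0 γ ; hi≤H = ℕ.≤-trans probe≤hi (hi≤H γ) ; wide = ℕ.≤-refl }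

  gap₀ : Gap rounds 1 H
  gap₀ = record { lo>0 = s≤s z≤n ; hi≤H = ℕ.≤-refl ; wide = ℕ.≤-reflexive (ℕ.*-identityʳ H) }

  -- `τ lo` is space for `k + s` small weights, as many as an offline bin may receive; an item of
  -- weight `room lo` leaves exactly this much.
  τ room : ℕ → ℕ
  τ lo = (k + s) * lo
  room lo = D ∸ τ lo

  module _ {r lo hi} (γ : Gap r lo hi) where

    -- `(k + s) * lo < g * lo`, and the gap always contains a factor of at least `g`. Hence items of
    -- weight `room lo` can be used while rounds remain, as the middle items do.
    τ<hi : τ lo < hi
    τ<hi = ℕ.<-≤-trans (ℕ.m<n+m (τ lo) (lo>0 γ))
      (ℕ.≤-trans (ℕ.*-monoˡ-≤ lo (width-≥g r)) (wide γ))

    τ≤H : τ lo ≤ H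
    τ≤H = ℕ.≤-trans (ℕ.<⇒≤ τ<hi) (hi≤H γ)

    lo≤H : lo ≤ H
    lo≤H = ℕ.≤-trans (ℕ.m≤n*m lo (k + s) {{ℕ.>-nonZero (ℕ.≤-trans (s≤s z≤n) (ℕ.m≤n+m s k))}}) τ≤H

    room+τ : room lo + τ lo ≡ D
    room+τ = ℕ.m∸n+n≡m (ℕ.≤-trans τ≤H (ℕ.≤-trans H≤unit unit≤D))

    D<room+hi : D < room lo + hi
    D<room+hi = subst (_< room lo + hi) room+τ (ℕ.+-monoʳ-< (room lo) τ<hi)

    hi≤room : hi ≤ room lo
    hi≤room = ℕ.m+n≤o⇒m≤o∸n hi (ℕ.≤-trans
      (ℕ.+-mono-≤ (ℕ.≤-trans (hi≤H γ) H≤unit) (ℕ.≤-trans τ≤H H≤unit)) unit+unit≤D)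

    hi>0 : 0 < hi
    hi>0 = ℕ.≤-<-trans z≤n τ<hi

  -- Coordinates and tiny items.

  P : Set
  P = Piece (suc (suc s)) D

  -- Coordinate zero limits the tiny items per bin, `label` decides which bins are closed to big
  -- items, and `blocker i` keeps the middle items of type `i` apart.
  pattern label    = suc zero
  pattern blocker i = suc (suc i)

  -- With the same weight in all coordinates but zero, one large tiny item closes its bin to middle
  -- items of every type and to big items.
  tiny : ∀ v → v ≤ H → P
  tiny v v≤H = record
    { weight   = λ { zero → unit ; (suc _) → v }
    ; weight≤D = λ { zero → unit≤D ; (suc _) → ℕ.≤-trans v≤H (ℕ.≤-trans H≤unit unit≤D) }
    ; axis     = zero
    ; axis>0   = 0<unit
    }

  record Tiny (B : ℕ) (w : P) : Set where
    field
      tiny-unit  : weight w zero ≡ unit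
      tiny-bound : ∀ j → weight w (suc j) ≤ B

  open Tiny public

  Tiny-mono : ∀ {B B′} → B ≤ B′ → ∀ {w} → Tiny B w → Tiny B′ w
  Tiny-mono B≤B′ t = record
    { tiny-unit = tiny-unit t ; tiny-bound = λ j → ℕ.≤-trans (tiny-bound t j) B≤B′ }

  open Scaled {suc (suc s)} D public

  module Play (A : OnlineAlgorithm (suc (suc s))) where

    open Run
    open Response

    -- State after `t` items with `r` rounds to go. `larges` are the items that opened the bins,
    -- whence `#larges`.
    record TinyPhase (t r : ℕ) : Set where
      field
        run           : Run A
        {lo hi}       : ℕ
        gap           : Gap r lo hi
        larges smalls : List P
        split         : seq run ↭ larges ++ smalls
        #larges       : length larges ≡ length (held run)
        #items        : length larges + length smalls ≡ t
        larges-tiny   : All (Tiny H) larges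
        smalls-tiny   : All (Tiny lo) smalls
        opened        : All (λ b → ∀ j → Hit (suc j) hi b) (held run)

    module TinyStep {t r : ℕ} (S : TinyPhase t (suc r)) where
      open TinyPhase S

      v : ℕ
      v = probe r lo

      v≤H : v ≤ H
      v≤H = ℕ.≤-trans (probe≤hi gap) (hi≤H gap)

      w : P
      w = tiny v v≤H

      ρ : Response A run w
      ρ = present A run w

      next : TinyPhase (suc t) r
      next with Put-case (put ρ)
      ... | inj₁ grown = record
        { run = after ρ
        ; gap = lower gap
        ; larges = w ∷ larges
        ; smalls = smalls
        ; split = ↭-trans (seq↭ ρ) (prep w split)
        ; #larges = trans (cong suc #larges) (sym grown)
        ; #items = cong suc #items
        ; larges-tiny = record { tiny-unit = refl ; tiny-bound = λ _ → v≤H } ∷ larges-tiny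
        ; smalls-tiny = smalls-tiny
        ; opened = Put-All (put ρ) (λ h j → Hit-mono (probe≤hi gap) (h j)) (λ j → here ℕ.≤-refl) opened
        }
      -- The item joined a bin that already had a large item, so it can be declared small and
      -- `opened` persists.
      ... | inj₂ (same , source) = record
        { run = after ρ
        ; gap = raise gap
        ; larges = larges
        ; smalls = w ∷ smalls
        ; split = ↭-trans (seq↭ ρ) (↭-trans (prep w split) (↭-sym (↭.shift w larges smalls)))
        ; #larges = trans #larges (sym same)
        ; #items = trans (ℕ.+-suc (length larges) (length smalls)) (cong suc #items)
        ; larges-tiny = larges-tiny
        ; smalls-tiny = record { tiny-unit = refl ; tiny-bound = λ _ → ℕ.≤-refl } ∷
                        All.map (Tiny-mono (lo≤probe r lo)) smalls-tiny
        ; opened = Put-All (put ρ) id (λ j → there (source opened j)) opened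
        }

    tinyPhase : ∀ t r → r + t ≡ rounds → TinyPhase t r
    tinyPhase zero r eq = record
      { run = startRun A
      ; gap = subst (λ r → Gap r 1 H) (trans (sym eq) (ℕ.+-identityʳ r)) gap₀
      ; larges = [] ; smalls = [] ; split = ↭-refl ; #larges = refl ; #items = refl
      ; larges-tiny = [] ; smalls-tiny = [] ; opened = []
      }
    tinyPhase (suc t) r eq = TinyStep.next (tinyPhase t (suc r) (trans (sym (ℕ.+-suc r t)) eq))

    -- Offline bins and middle items.

    module Stages (T : TinyPhase (n * k) (s * n)) where
      -- Blocker coordinates keep the thresholds `lo₁` and `hi₁` reached here; only `label`
      -- continues with a moving gap.
      open TinyPhase T using () renaming
        (run to run₁; lo to lo₁; hi to hi₁; gap to gap₁; larges to larges₁; smalls to smalls₁)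

      X : ℕ
      X = length (held run₁)

      record Loaded (i B : ℕ) (b : List P) : Set where
        field
          units  : total zero b ≤ D
          labels : total label b ≤ (k + i) * B
          done   : ∀ j → toℕ j < i → total (blocker j) b ≤ D
          todo   : ∀ j → i ≤ toℕ j → total (blocker j) b ≤ τ lo₁

      open Loaded

      record Mid (i : Fin s) (B : ℕ) (w : P) : Set where
        field
          mid-zero  : weight w zero ≡ 0
          mid-label : weight w label ≤ B
          mid-own   : weight w (blocker i) ≡ room lo₁
          mid-other : ∀ j → j ≢ i → weight w (blocker j) ≡ 0

      open Mid

      Mid-mono : ∀ {i B B′} → B ≤ B′ → ∀ {w} → Mid i B w → Mid i B′ w
      Mid-mono B≤B′ μ = record
        { mid-zero = mid-zero μ ; mid-label = ℕ.≤-trans (mid-label μ) B≤B′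
        ; mid-own = mid-own μ ; mid-other = mid-other μ }

      Loaded-∷ : ∀ {i B B′ w b} → B ≤ B′ → Mid i B′ w → Loaded (toℕ i) B b →
                 Loaded (suc (toℕ i)) B′ (w ∷ b)
      Loaded-∷ {i} {B} {B′} {w} {b} B≤B′ μ ℓ = record
        { units  = subst (λ x → x + total zero b ≤ D) (sym (mid-zero μ)) (units ℓ)
        ; labels = ℕ.≤-trans
            (ℕ.+-mono-≤ (mid-label μ) (ℕ.≤-trans (labels ℓ) (ℕ.*-monoʳ-≤ (k + toℕ i) B≤B′)))
            (ℕ.≤-reflexive (cong (_* B′) (sym (ℕ.+-suc k (toℕ i)))))
        ; done   = done′
        ; todo   = λ j i<j → subst (λ x → x + total (blocker j) b ≤ τ lo₁)
            (sym (mid-other μ j (λ { refl → ℕ.<-irrefl refl i<j }))) (todo ℓ j (ℕ.<⇒≤ i<j))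
        }
        where
        done′ : ∀ j → toℕ j < suc (toℕ i) → total (blocker j) (w ∷ b) ≤ D
        done′ j j≤i with j Fin.≟ i
        ... | yes refl = subst₂ (λ x y → x + total (blocker i) b ≤ y) (sym (mid-own μ)) (room+τ gap₁)
                                (ℕ.+-monoʳ-≤ (room lo₁) (todo ℓ i ℕ.≤-refl))
        ... | no j≢i = subst (λ x → x + total (blocker j) b ≤ D) (sym (mid-other μ j j≢i))
                             (done ℓ j (ℕ.≤∧≢⇒< (ℕ.≤-pred j≤i) (j≢i ∘ Fin.toℕ-injective)))

      spike : (i j : Fin s) → ℕ
      spike i j with j Fin.≟ i
      ... | yes _ = room lo₁
      ... | no  _ = 0

      spike-own : ∀ i → spike i i ≡ room lo₁
      spike-own i with i Fin.≟ i
      ... | yes _  = refl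
      ... | no i≢i = contradiction refl i≢i

      spike-other : ∀ i j → j ≢ i → spike i j ≡ 0
      spike-other i j j≢i with j Fin.≟ i
      ... | yes j≡i = contradiction j≡i j≢i
      ... | no  _   = refl

      spike≤D : ∀ i j → spike i j ≤ D
      spike≤D i j with j Fin.≟ i
      ... | yes _ = ℕ.m∸n≤m D (τ lo₁)
      ... | no  _ = z≤n

      mid : ∀ i v → v ≤ H → P
      mid i v v≤H = record
        { weight   = λ { zero → 0 ; label → v ; (blocker j) → spike i j }
        ; weight≤D = λ { zero → z≤n ; label → ℕ.≤-trans v≤H (ℕ.≤-trans H≤unit unit≤D)
                       ; (blocker j) → spike≤D i j }
        ; axis     = blocker i
        ; axis>0   = subst (0 <_) (sym (spike-own i)) (ℕ.<-≤-trans (hi>0 gap₁) (hi≤room gap₁))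
        }

      mid-Mid : ∀ i v v≤H → Mid i v (mid i v v≤H)
      mid-Mid i v v≤H = record
        { mid-zero = refl ; mid-label = ℕ.≤-refl ; mid-own = spike-own i ; mid-other = spike-other i }

      -- The state before the middle items of type i.  The offline packing puts
      -- only small items in the good bins, which will each receive a big item.
      record Stage (i r : ℕ) : Set where
        field
          run         : Run A
          {lo hi}     : ℕ
          gap         : Gap r lo hi
          good rest   : List (List P)
          #good       : length good ≡ q * m
          #rest       : length rest ≡ m
          packed      : larges₁ ++ (concat good ++ concat rest) ↭ seq run
          good-loaded : All (Loaded i lo) good
          rest-loaded : All (Loaded i H) rest
          heavy       : n * D ≤ total zero (seq run)
          labelled    : X + i * m ≤ hits label hi (held run)
          blocked     : ∀ j → i ≤ toℕ j → X ≤ hits (blocker j) hi₁ (held run)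
          nested      : ∀ j → i ≤ toℕ j →
                        All (λ b → Hit (blocker j) hi₁ b → Hit label hi b) (held run)

      -- Presenting one type of middle items.

      module MidStage {i : Fin s} {r : ℕ} (S : Stage (toℕ i) (n + r)) where
        private module S = Stage S

        -- Unless the quota of `m` large items is met, `own-nested` places all bins closed to type
        -- `i` among those with a large label, and `own-blocked` makes them numerous.
        record MidPhase (t r′ : ℕ) : Set where
          field
            run           : Run A
            {lo hi}       : ℕ
            gap           : Gap r′ lo hi
            lo-grows      : S.lo ≤ lo
            larges smalls : List P
            split         : seq run ↭ (larges ++ smalls) ++ seq S.run
            #items        : length larges + length smalls ≡ t
            #larges       : length larges ≤ m
            larges-mid    : All (Mid i H) larges
            smalls-mid    : All (Mid i lo) smalls
            labelled      : X + toℕ i * m + length larges ≤ hits label hi (held run)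
            own-blocked   : X + t ≤ hits (blocker i) hi₁ (held run)
            own-nested    : length larges ≡ m ⊎
                            All (λ b → Hit (blocker i) hi₁ b → Hit label hi b) (held run)
            blocked       : ∀ j → toℕ i < toℕ j → X ≤ hits (blocker j) hi₁ (held run)
            nested        : ∀ j → toℕ i < toℕ j →
                            All (λ b → Hit (blocker j) hi₁ b → Hit label hi b) (held run)

        module MidStep {t r′ : ℕ} (M : MidPhase t (suc r′)) where
          open MidPhase M

          v : ℕ
          v = probe r′ lo

          v≤H : v ≤ H
          v≤H = ℕ.≤-trans (probe≤hi gap) (hi≤H gap)

          w : P
          w = mid i v v≤H

          μ : Mid i v w
          μ = mid-Mid i v v≤H

          ρ : Response A run w
          ρ = present A run w

          -- As `room lo₁ + hi₁` exceeds `D`, the target had no blocker weight of `hi₁` or more,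
          -- neither from a large tiny item nor from an earlier item of this type; the new item
          -- provides one.
          own-blocked′ : X + suc t ≤ hits (blocker i) hi₁ (held (after ρ))
          own-blocked′ = ℕ.≤-trans (ℕ.≤-reflexive (ℕ.+-suc X t)) (ℕ.≤-<-trans own-blocked
            (hits-< (put ρ) (blocker i) ℕ.≤-refl
              (fits⇒¬Hit {w = w} (blocker i) (target-fits ρ)
                (subst (λ x → D < x + hi₁) (sym (mid-own μ)) (D<room+hi gap₁)))
              (subst (hi₁ ≤_) (sym (mid-own μ)) (hi≤room gap₁))))

          blocked′ : ∀ j → toℕ i < toℕ j → X ≤ hits (blocker j) hi₁ (held (after ρ))
          blocked′ j i<j = ℕ.≤-trans (blocked j i<j) (hits-≤ (put ρ) (blocker j) ℕ.≤-refl)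

          -- The new item is zero in the other blockers, so a hit there stems from what the target
          -- held before.
          nested′ : ∀ {hi′} → hi′ ≤ hi → ∀ j → toℕ i < toℕ j →
                    All (λ b → Hit (blocker j) hi₁ b → Hit label hi′ b) (held (after ρ))
          nested′ hi′≤hi j i<j = Put-All (put ρ) (Hit-mono hi′≤hi ∘_)
            (λ { (here le) → contradiction
                   (ℕ.≤-trans (hi>0 gap₁)
                     (subst (hi₁ ≤_) (mid-other μ j (λ { refl → ℕ.<-irrefl refl i<j })) le))
                   λ ()
               ; (there h) → there (Hit-mono hi′≤hi (Put-source (put ρ) (λ ()) (nested j i<j) h)) })
            (nested j i<j)

          -- The newly blocked bin does no harm: either it has a large label already, or the quota
          -- is met and nesting is no longer maintained.
          keepSmall : length larges ≡ m ⊎ Hit label hi (target ρ) → MidPhase (suc t) r′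
          keepSmall why = record
            { run = after ρ
            ; gap = raise gap
            ; lo-grows = ℕ.≤-trans lo-grows (lo≤probe r′ lo)
            ; larges = larges
            ; smalls = w ∷ smalls
            ; split = ↭-trans (seq↭ ρ) (↭-trans (prep w split)
                (↭.++⁺ʳ (seq S.run) (↭-sym (↭.shift w larges smalls))))
            ; #items = trans (ℕ.+-suc (length larges) (length smalls)) (cong suc #items)
            ; #larges = #larges
            ; larges-mid = larges-mid
            ; smalls-mid = μ ∷ All.map (Mid-mono (lo≤probe r′ lo)) smalls-mid
            ; labelled = ℕ.≤-trans labelled (hits-≤ (put ρ) label ℕ.≤-refl)
            ; own-blocked = own-blocked′
            ; own-nested = own-nested′ why own-nested
            ; blocked = blocked′
            ; nested = nested′ ℕ.≤-refl
            }
            where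
            own-nested′ : length larges ≡ m ⊎ Hit label hi (target ρ) →
                          length larges ≡ m ⊎
                          All (λ b → Hit (blocker i) hi₁ b → Hit label hi b) (held run) →
                          length larges ≡ m ⊎
                          All (λ b → Hit (blocker i) hi₁ b → Hit label hi b) (held (after ρ))
            own-nested′ (inj₁ full) _           = inj₁ full
            own-nested′ (inj₂ _)    (inj₁ full) = inj₁ full
            own-nested′ (inj₂ h)    (inj₂ ns)   = inj₂ (Put-All (put ρ) id (λ _ → there h) ns)

          makeLarge : length larges < m → ¬ Hit label hi (target ρ) → MidPhase (suc t) r′
          makeLarge room ¬h = record
            { run = after ρ
            ; gap = lower gap
            ; lo-grows = lo-grows
            ; larges = w ∷ larges
            ; smalls = smalls
            ; split = ↭-trans (seq↭ ρ) (prep w split)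
            ; #items = cong suc #items
            ; #larges = room
            ; larges-mid = Mid-mono v≤H μ ∷ larges-mid
            ; smalls-mid = smalls-mid
            ; labelled = ℕ.≤-trans (ℕ.≤-reflexive (ℕ.+-suc (X + toℕ i * m) (length larges)))
                (ℕ.≤-<-trans labelled (hits-< (put ρ) label (probe≤hi gap) ¬h ℕ.≤-refl))
            ; own-blocked = own-blocked′
            ; own-nested = own-nested′ own-nested
            ; blocked = blocked′
            ; nested = nested′ (probe≤hi gap)
            }
            where
            own-nested′ : length larges ≡ m ⊎
                          All (λ b → Hit (blocker i) hi₁ b → Hit label hi b) (held run) →
                          suc (length larges) ≡ m ⊎
                          All (λ b → Hit (blocker i) hi₁ b → Hit label v b) (held (after ρ))
            own-nested′ (inj₁ full) = contradiction full (ℕ.<⇒≢ room)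
            own-nested′ (inj₂ ns)   = inj₂ (Put-All (put ρ) (Hit-mono (probe≤hi gap) ∘_)
                                                    (λ _ → here ℕ.≤-refl) ns)

          next : MidPhase (suc t) r′
          next with length larges ℕ.≟ m | hit? label hi (target ρ)
          ... | yes full | _     = keepSmall (inj₁ full)
          ... | no _     | yes h = keepSmall (inj₂ h)
          ... | no ¬full | no ¬h = makeLarge (ℕ.≤∧≢⇒< #larges ¬full) ¬h

        midPhase : ∀ t r′ → r′ + t ≡ n + r → MidPhase t r′
        midPhase zero r′ eq = record
          { run = S.run
          ; gap = subst (λ r → Gap r S.lo S.hi) (trans (sym eq) (ℕ.+-identityʳ r′)) S.gap
          ; lo-grows = ℕ.≤-refl
          ; larges = [] ; smalls = [] ; split = ↭-refl ; #items = refl ; #larges = z≤n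
          ; larges-mid = [] ; smalls-mid = []
          ; labelled = ℕ.≤-trans (ℕ.≤-reflexive (ℕ.+-identityʳ _)) S.labelled
          ; own-blocked = ℕ.≤-trans (ℕ.≤-reflexive (ℕ.+-identityʳ X)) (S.blocked i ℕ.≤-refl)
          ; own-nested = inj₂ (S.nested i ℕ.≤-refl)
          ; blocked = λ j i<j → S.blocked j (ℕ.<⇒≤ i<j)
          ; nested = λ j i<j → S.nested j (ℕ.<⇒≤ i<j)
          }
        midPhase (suc t) r′ eq = MidStep.next (midPhase t (suc r′) (trans (sym (ℕ.+-suc r′ t)) eq))

        module Finish (M : MidPhase n r) where
          open MidPhase M

          -- At most `m` of the `n` items are large, so `q * m` small ones are available for the
          -- good bins. Exactly `m` items remain, one for each bin of `rest`.
          ps qs : List P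
          ps = take (q * m) smalls
          qs = drop (q * m) smalls ++ larges

          ps-enough : q * m ≤ length smalls
          ps-enough = ℕ.+-cancelˡ-≤ m _ _ (ℕ.≤-trans (ℕ.≤-reflexive (sym #items))
            (ℕ.+-monoˡ-≤ (length smalls) #larges))

          #ps : length ps ≡ q * m
          #ps = trans (length-take (q * m) smalls) (ℕ.m≤n⇒m⊓n≡m ps-enough)

          #qs : length qs ≡ m
          #qs = ℕ.+-cancelˡ-≡ (q * m) _ _ (begin
            q * m + length qs ≡⟨ cong (_+ length qs) #ps ⟨
            length ps + length qs ≡⟨ length-++ ps ⟨
            length (ps ++ qs) ≡⟨ cong length (++-assoc ps (drop (q * m) smalls) larges) ⟨
            length ((ps ++ drop (q * m) smalls) ++ larges) ≡⟨ cong (λ xs → length (xs ++ larges)) (take++drop≡id (q * m) smalls) ⟩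
            length (smalls ++ larges) ≡⟨ length-++ smalls ⟩
            length smalls + length larges ≡⟨ ℕ.+-comm (length smalls) (length larges) ⟩
            length larges + length smalls ≡⟨ #items ⟩
            m + q * m ≡⟨ ℕ.+-comm m (q * m) ⟩
            q * m + m ∎)
            where open ≡-Reasoning

          ps++qs : ps ++ qs ↭ larges ++ smalls
          ps++qs = ↭-trans (↭-reflexive (trans (sym (++-assoc ps (drop (q * m) smalls) larges))
              (cong (_++ larges) (take++drop≡id (q * m) smalls))))
            (↭.++-comm smalls larges)

          packed′ : larges₁ ++ (concat (onto ps S.good) ++ concat (onto qs S.rest)) ↭ seq run
          packed′ = begin
            larges₁ ++ (concat (onto ps S.good) ++ concat (onto qs S.rest))
              ↭⟨ ↭.++⁺ˡ larges₁ (↭.++⁺ (concat-onto ps S.good (trans #ps (sym S.#good)))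
                                       (concat-onto qs S.rest (trans #qs (sym S.#rest)))) ⟩
            larges₁ ++ ((ps ++ concat S.good) ++ (qs ++ concat S.rest))
              ↭⟨ ↭.++⁺ˡ larges₁ (++-interchange ps (concat S.good) qs (concat S.rest)) ⟩
            larges₁ ++ ((ps ++ qs) ++ (concat S.good ++ concat S.rest))
              ↭⟨ ↭.shifts larges₁ (ps ++ qs) ⟩
            (ps ++ qs) ++ (larges₁ ++ (concat S.good ++ concat S.rest))
              ↭⟨ ↭.++⁺ ps++qs S.packed ⟩
            (larges ++ smalls) ++ seq S.run
              ↭⟨ split ⟨
            seq run ∎
            where open PermutationReasoning

          -- If the quota is met, the count has grown by `m`. Otherwise at least `X + n` bins are
          -- blocked for type `i`, all with a large label, and `n` is at least `suc (toℕ i) * m`.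
          labelled′ : X + suc (toℕ i) * m ≤ hits label hi (held run)
          labelled′ with own-nested
          ... | inj₁ full = ℕ.≤-trans (ℕ.≤-reflexive (begin
            X + (m + toℕ i * m) ≡⟨ cong (λ x → X + x) (ℕ.+-comm m (toℕ i * m)) ⟩
            X + (toℕ i * m + m) ≡⟨ ℕ.+-assoc X (toℕ i * m) m ⟨
            X + toℕ i * m + m   ≡⟨ cong (λ x → X + toℕ i * m + x) full ⟨
            X + toℕ i * m + length larges ∎)) labelled
            where open ≡-Reasoning
          ... | inj₂ ns = ℕ.≤-trans (ℕ.+-monoʳ-≤ X (ℕ.*-monoˡ-≤ m (Fin.toℕ<n i)))
            (ℕ.≤-trans own-blocked (filter-mono-≤ (hit? (blocker i) hi₁) (hit? label hi) ns))

          nextStage : Stage (suc (toℕ i)) r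
          nextStage = record
            { run = run
            ; gap = gap
            ; good = onto ps S.good
            ; rest = onto qs S.rest
            ; #good = trans (length-onto ps S.good (trans #ps (sym S.#good))) S.#good
            ; #rest = trans (length-onto qs S.rest (trans #qs (sym S.#rest))) S.#rest
            ; packed = packed′
            ; good-loaded = onto-All (Loaded-∷ lo-grows) (All.take⁺ (q * m) smalls-mid) S.good-loaded
            ; rest-loaded = onto-All (Loaded-∷ ℕ.≤-refl)
                (All.++⁺ (All.drop⁺ (q * m) (All.map (Mid-mono (lo≤H gap)) smalls-mid)) larges-mid)
                S.rest-loaded
            ; heavy = ℕ.≤-trans S.heavy (ℕ.≤-trans (ℕ.m≤n+m _ (total zero (larges ++ smalls)))
                (ℕ.≤-reflexive (sym (trans (total-↭ zero split)
                  (total-++ zero (larges ++ smalls) (seq S.run))))))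
            ; labelled = labelled′
            ; blocked = blocked
            ; nested = nested
            }

      -- From the tiny items to the first stage.

      module _ where
        open TinyPhase T

        #smalls : length smalls ≤ q * m * k + m * k
        #smalls = begin
          length smalls ≤⟨ ℕ.m≤n+m (length smalls) (length larges) ⟩
          length larges + length smalls ≡⟨ #items ⟩
          (m + q * m) * k ≡⟨ cong (_* k) (ℕ.+-comm m (q * m)) ⟩
          (q * m + m) * k ≡⟨ ℕ.*-distribʳ-+ k (q * m) m ⟩
          q * m * k + m * k ∎
          where open ℕ.≤-Reasoning

        heavy₁ : n * D ≤ total zero (seq run)
        heavy₁ = begin
          n * D ≡⟨ ℕ.*-assoc n k unit ⟨
          n * k * unit ≡⟨ cong (_* unit) (trans (length-++ larges) #items) ⟨
          length (larges ++ smalls) * unit ≤⟨ total-≥ zero (All.map (ℕ.≤-reflexive ∘ sym ∘ tiny-unit)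
            (All.++⁺ larges-tiny (All.map (Tiny-mono (lo≤H gap)) smalls-tiny))) ⟩
          total zero (larges ++ smalls) ≡⟨ total-↭ zero split ⟨
          total zero (seq run) ∎
          where open ℕ.≤-Reasoning

        -- Volume in coordinate zero: `n * k` items of size `1 / k` need `n` bins, however the
        -- algorithm packs them.
        n≤X : n ≤ X
        n≤X = ℕ.*-cancelʳ-≤ n X D (ℕ.≤-trans heavy₁ (run-volume A run zero))

        chunk-loaded : ∀ {B b} → lo ≤ B → length b ≤ k × All (Tiny lo) b → Loaded 0 B b
        chunk-loaded {B} {b} lo≤B (len , ts) = record
          { units  = ℕ.≤-trans (total-≤ zero (All.map (ℕ.≤-reflexive ∘ tiny-unit) ts))
                               (ℕ.*-monoˡ-≤ unit len)
          ; labels = ℕ.≤-trans (total-≤ label (All.map (λ t → ℕ.≤-trans (tiny-bound t zero) lo≤B) ts))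
                               (ℕ.*-monoˡ-≤ B (ℕ.≤-trans len (ℕ.m≤m+n k 0)))
          ; done   = λ _ ()
          ; todo   = λ j _ → ℕ.≤-trans (total-≤ (blocker j) (All.map (λ t → tiny-bound t (suc j)) ts))
                               (ℕ.*-monoˡ-≤ lo (ℕ.≤-trans len (ℕ.m≤m+n k s)))
          }

        stage₀ : Stage 0 (s * n)
        stage₀ = record
          { run = run
          ; gap = gap
          ; good = chunks k (q * m) (take (q * m * k) smalls)
          ; rest = chunks k m (drop (q * m * k) smalls)
          ; #good = length-chunks k (q * m) _
          ; #rest = length-chunks k m _
          ; packed = ↭-trans (↭-reflexive (cong (larges ++_) (trans
              (cong₂ _++_
                (concat-chunks k (q * m) _ (subst (_≤ q * m * k) (sym (length-take (q * m * k) smalls))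
                  (ℕ.m⊓n≤m (q * m * k) _)))
                (concat-chunks k m _ (subst (_≤ m * k) (sym (length-drop (q * m * k) smalls))
                  (ℕ.m≤n+o⇒m∸n≤o (length smalls) (q * m * k) #smalls))))
              (take++drop≡id (q * m * k) smalls)))) (↭-sym split)
          ; good-loaded = All.map (chunk-loaded ℕ.≤-refl)
              (chunks-All k (q * m) (All.take⁺ (q * m * k) smalls-tiny))
          ; rest-loaded = All.map (chunk-loaded (lo≤H gap))
              (chunks-All k m (All.drop⁺ (q * m * k) smalls-tiny))
          ; heavy = heavy₁
          ; labelled = ℕ.≤-trans (ℕ.≤-reflexive (ℕ.+-identityʳ X)) (all-hit zero)
          ; blocked = λ j _ → all-hit (suc j)
          ; nested = λ j _ → All.map (λ h _ → h zero) opened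
          }
          where
          all-hit : ∀ j → X ≤ hits (suc j) hi (held run)
          all-hit j = ℕ.≤-reflexive (cong length (sym
            (filter-all (hit? (suc j) hi) (All.map (λ h → h j) opened))))

      stage : ∀ i l → i + l ≡ s → Stage i (l * n)
      stage zero    l eq = subst (λ l → Stage 0 (l * n)) (sym eq) stage₀
      stage (suc i) l eq = subst (λ i → Stage (suc i) (l * n)) (Fin.toℕ-fromℕ< i<s)
        (Finish.nextStage (midPhase n (l * n) (ℕ.+-comm (l * n) n)))
        where
        i<s : i < s
        i<s = ℕ.≤-trans (ℕ.m≤m+n (suc i) l) (ℕ.≤-reflexive eq)

        previous : Stage (toℕ (Fin.fromℕ< i<s)) (n + l * n)
        previous = subst (λ i → Stage i (n + l * n)) (sym (Fin.toℕ-fromℕ< i<s))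
          (stage i (suc l) (trans (ℕ.+-suc i l) eq))

        open MidStage previous

      -- Big items and the offline packing.

      module Endgame (S : Stage s 0) where
        private module S = Stage S

        big : P
        big = record
          { weight   = λ { zero → 0 ; label → room S.lo ; (blocker _) → 0 }
          ; weight≤D = λ { zero → z≤n ; label → ℕ.m∸n≤m D (τ S.lo) ; (blocker _) → z≤n }
          ; axis     = label
          ; axis>0   = ℕ.<-≤-trans (hi>0 S.gap) (hi≤room S.gap)
          }

        -- `labelled` counts bins of big items too, as `room S.lo` is at least `S.hi`. So a big item
        -- avoids large items and earlier big items for the same reason.
        record BigPhase (t : ℕ) : Set where
          field
            run      : Run A
            split    : seq run ↭ replicate t big ++ seq S.run
            labelled : X + n + t ≤ hits label S.hi (held run)

        bigPhase : ∀ t → BigPhase t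
        bigPhase zero = record
          { run = S.run ; split = ↭-refl
          ; labelled = ℕ.≤-trans (ℕ.≤-reflexive (ℕ.+-identityʳ (X + n))) S.labelled }
        bigPhase (suc t) = record
          { run = after ρ
          ; split = ↭-trans (seq↭ ρ) (prep big split)
          ; labelled = ℕ.≤-trans (ℕ.≤-reflexive (ℕ.+-suc (X + n) t)) (ℕ.≤-<-trans labelled
              (hits-< (put ρ) label ℕ.≤-refl
                (fits⇒¬Hit {w = big} label (target-fits ρ) (D<room+hi S.gap)) (hi≤room S.gap)))
          }
          where
          open BigPhase (bigPhase t)

          ρ : Response A run big
          ρ = present A run big

        open BigPhase (bigPhase (q * m))

        input : List (Item (suc (suc s)))
        input = map item (seq run)

        cost-≥ : X + n + q * m ≤ OnlineAlgorithm.cost A input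
        cost-≥ = ℕ.≤-trans labelled (ℕ.≤-trans (length-filter (hit? label S.hi) (held run))
          (ℕ.≤-reflexive (sym (run-cost A run))))

        n≤OPT : n ≤ OPT input
        n≤OPT = OPT-≥ (seq run) zero n (ℕ.≤-trans S.heavy
          (ℕ.≤-trans (ℕ.m≤n+m _ (total zero (replicate (q * m) big)))
            (ℕ.≤-reflexive (sym (trans (total-↭ zero split)
              (total-++ zero (replicate (q * m) big) (seq S.run)))))))

        leftovers : List (List P)
        -- Rounding up costs at most one bin beyond `X / k`, which is negligible in the limit.
        leftovers = chunks k (suc (X div k)) larges₁

        packing : List (List P)
        packing = onto (replicate (q * m) big) S.good ++ (S.rest ++ leftovers)

        bigs-match : length (replicate (q * m) big) ≡ length S.good
        bigs-match = trans (length-replicate (q * m)) (sym S.#good)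

        packing-↭ : concat packing ↭ seq run
        packing-↭ = begin
          concat packing
            ≡⟨ concat-++ (onto bigs S.good) (S.rest ++ leftovers) ⟨
          concat (onto bigs S.good) ++ concat (S.rest ++ leftovers)
            ≡⟨ cong (concat (onto bigs S.good) ++_) (concat-++ S.rest leftovers) ⟨
          concat (onto bigs S.good) ++ (concat S.rest ++ concat leftovers)
            ≡⟨ cong (λ xs → concat (onto bigs S.good) ++ (concat S.rest ++ xs))
                 (concat-chunks k (suc (X div k)) larges₁ enough) ⟩
          concat (onto bigs S.good) ++ (concat S.rest ++ larges₁)
            ↭⟨ ↭.++⁺ʳ _ (concat-onto bigs S.good bigs-match) ⟩
          (bigs ++ concat S.good) ++ (concat S.rest ++ larges₁)
            ≡⟨ ++-assoc bigs (concat S.good) _ ⟩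
          bigs ++ (concat S.good ++ (concat S.rest ++ larges₁))
            ≡⟨ cong (bigs ++_) (++-assoc (concat S.good) (concat S.rest) larges₁) ⟨
          bigs ++ ((concat S.good ++ concat S.rest) ++ larges₁)
            ↭⟨ ↭.++⁺ˡ bigs (↭.++-comm (concat S.good ++ concat S.rest) larges₁) ⟩
          bigs ++ (larges₁ ++ (concat S.good ++ concat S.rest))
            ↭⟨ ↭.++⁺ˡ bigs S.packed ⟩
          bigs ++ seq S.run
            ↭⟨ split ⟨
          seq run ∎
          where
          open PermutationReasoning

          bigs : List P
          bigs = replicate (q * m) big

          enough : length larges₁ ≤ suc (X div k) * k
          enough = ℕ.≤-trans (ℕ.≤-reflexive (TinyPhase.#larges T)) 
            (ℕ.≤-trans (ℕ.≤-reflexive (m≡m%n+[m/n]*n X k))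
              (ℕ.+-monoˡ-≤ (X div k * k) (ℕ.<⇒≤ (m%n<n X k))))

        -- In `label`, `room` and `τ` add up to exactly `D` in good bins, while in `rest` even
        -- `k + s` labels of size `H` stay below one `unit`. Leftover bins hold at most `k` items,
        -- each at most `unit` in every coordinate.
        packing-fits : All FitsWithin packing
        packing-fits = All.++⁺ (onto-All {P = _≡ big} {Q = Loaded s S.lo} big-fits (All.replicate⁺ (q * m) refl) S.good-loaded)
          (All.++⁺ (All.map rest-fits S.rest-loaded)
            (All.map leftover-fits (chunks-All k (suc (X div k)) (TinyPhase.larges-tiny T))))
          where
          big-fits : ∀ {x b} → x ≡ big → Loaded s S.lo b → FitsWithin (x ∷ b)
          big-fits refl ℓ zero        = units ℓ
          big-fits refl ℓ label       = ℕ.≤-trans (ℕ.+-monoʳ-≤ (room S.lo) (labels ℓ))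
                                                  (ℕ.≤-reflexive (room+τ S.gap))
          big-fits refl ℓ (blocker j) = done ℓ j (Fin.toℕ<n j)

          rest-fits : ∀ {b} → Loaded s H b → FitsWithin b
          rest-fits ℓ zero        = units ℓ
          rest-fits ℓ label       = ℕ.≤-trans (labels ℓ) (ℕ.≤-trans (ℕ.m≤n+m ((k + s) * H) H) unit≤D)
          rest-fits ℓ (blocker j) = done ℓ j (Fin.toℕ<n j)

          leftover-fits : ∀ {b} → length b ≤ k × All (Tiny H) b → FitsWithin b
          leftover-fits (len , ts) zero    = ℕ.≤-trans
            (total-≤ zero (All.map (ℕ.≤-reflexive ∘ tiny-unit) ts)) (ℕ.*-monoˡ-≤ unit len)
          leftover-fits (len , ts) (suc j) = ℕ.≤-trans
            (total-≤ (suc j) (All.map (λ t → ℕ.≤-trans (tiny-bound t j) H≤unit) ts))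
            (ℕ.*-monoˡ-≤ unit len)

        OPT≤ : OPT input ≤ n + suc (X div k)
        OPT≤ = ℕ.≤-trans (OPT-≤ (seq run) packing packing-↭ packing-fits) (ℕ.≤-reflexive (begin
          length packing
            ≡⟨ length-++ (onto (replicate (q * m) big) S.good) ⟩
          length (onto (replicate (q * m) big) S.good) + length (S.rest ++ leftovers)
            ≡⟨ cong₂ _+_ (trans (length-onto (replicate (q * m) big) S.good bigs-match) S.#good)
                         (trans (length-++ S.rest)
                                (cong₂ _+_ S.#rest (length-chunks k (suc (X div k)) larges₁))) ⟩
          q * m + (m + suc (X div k))
            ≡⟨ ℕ.+-assoc (q * m) m _ ⟨
          q * m + m + suc (X div k)
            ≡⟨ cong (_+ suc (X div k)) (ℕ.+-comm (q * m) m) ⟩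
          n + suc (X div k) ∎))
          where open ≡-Reasoning

-- The ratio in dimension 8.

hard-input : ∀ q k m .{{_ : NonZero k}} → 2 ≤ k → (A : OnlineAlgorithm (3 + q)) →
             ∃ λ L → ∃ λ X → suc q * m ≤ X × suc q * m ≤ OPT L ×
             X + suc q * m + q * m ≤ OnlineAlgorithm.cost A L ×
             OPT L ≤ suc q * m + suc (X div k)
hard-input q k m 2≤k A = input , X , n≤X , n≤OPT , cost-≥ , OPT≤
  where
  open Adversary q k m 2≤k
  open Play A
  open Stages (tinyPhase (n * k) (s * n) refl)
  open Endgame (stage s 0 (ℕ.+-identityʳ s))

-- For `k = 76` the term `76 * (X div 76)` is at most `X`, which reduces the claim to
-- `456 * m + 76 ≤ 28 * X + 319 * m`; there `X` is replaced by its lower bound `6 * m`.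
76OPT≤29cost : ∀ m {X opt cost} → 3 ≤ m → 6 * m ≤ X → X + 6 * m + 5 * m ≤ cost →
               opt ≤ 6 * m + suc (X div 76) → 76 * opt ≤ cost * 29
76OPT≤29cost m {X} {opt} {cost} 3≤m 6m≤X le-cost le-opt = begin
  76 * opt                                  ≤⟨ ℕ.*-monoʳ-≤ 76 le-opt ⟩
  76 * (6 * m + suc Y)
    ≡⟨ solve 2 (λ m Y → con 76 :* (con 6 :* m :+ (con 1 :+ Y))
                        := (Y :* con 76 :+ con 456 :* m) :+ con 76) refl m Y ⟩
  Y * 76 + 456 * m + 76
    ≤⟨ ℕ.+-mono-≤ (ℕ.+-monoˡ-≤ (456 * m) (m/n*n≤m X 76))
         -- The additive 76 is absorbed since `76 + 17 = 31 * 3`; the coefficient 31 is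
         -- `28 * 6 + 319 - 456`.
         (ℕ.≤-trans (ℕ.m≤m+n 76 17) (ℕ.*-monoʳ-≤ 31 3≤m)) ⟩
  X + 456 * m + 31 * m
    ≡⟨ solve 2 (λ X m → X :+ con 456 :* m :+ con 31 :* m
                        := (X :+ con 319 :* m) :+ con 28 :* (con 6 :* m)) refl X m ⟩
  X + 319 * m + 28 * (6 * m)                ≤⟨ ℕ.+-monoʳ-≤ (X + 319 * m) (ℕ.*-monoʳ-≤ 28 6m≤X) ⟩
  X + 319 * m + 28 * X
    ≡⟨ solve 2 (λ X m → X :+ con 319 :* m :+ con 28 :* X
                        := (X :+ con 6 :* m :+ con 5 :* m) :* con 29) refl X m ⟩
  (X + 6 * m + 5 * m) * 29                  ≤⟨ ℕ.*-monoˡ-≤ 29 le-cost ⟩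
  cost * 29                                 ∎
  where
  open ℕ.≤-Reasoning
  open +-*-Solver

  Y : ℕ
  Y = X div 76

theorem13 : ¬ (∃ λ (A : OnlineAlgorithm 8) → asymptoticCompetitiveRatio A <ᵣ (+ 76 / 29))
theorem13 (A , r , r<76/29 , N , eventually) =
  let r′ , r′<r , bound = eventually N ℕ.≤-refl
      -- `N` makes `OPT L` large enough for the bound on the ratios; 3 meets the condition of
      -- `76OPT≤29cost`.
      m = N + 3
      -- `q = 5` means six types of middle items and dimension `3 + 5 = 8`.
      L , X , 6m≤X , 6m≤OPT , cost≥ , OPT≤ = hard-input 5 76 m (s≤s (s≤s z≤n)) A
      m≤OPT = ℕ.≤-trans (ℕ.m≤n*m m 6) 6m≤OPT
      OPT≢0 = ℕ.>-nonZero (ℕ.<-≤-trans (s≤s z≤n) (ℕ.≤-trans (ℕ.m≤n+m 3 N) m≤OPT))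
      ratio<76/29 = ℚ.≤-<-trans
        (bound _ (L , ℕ.≤-trans (ℕ.m≤m+n N 3) m≤OPT , OPT≢0 , refl))
        (ℚ.<-trans r′<r r<76/29)
  in ℕ.<⇒≱ (/-cancel-< (OnlineAlgorithm.cost A L) (OPT L) 76 29 {{OPT≢0}} ratio<76/29)
       (76OPT≤29cost m (ℕ.m≤n+m 3 N) 6m≤X cost≥ OPT≤)
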